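{- (a) In each of the classes of frames K, KD, KD45 and S5, a formula $\varphi$ is unknowable iff $\varphi\leftrightarrow(\varphi\land\lnot\Box\varphi)$ is valid. (b) In each of K and KD, if $\varphi$ is unbelievable then $\varphi$ is unknowable, but the converse does not hold (i.e. in each of these classes there is a formula that is unknowable but believable). (c) In each of KD45 and S5, $\varphi$ is unbelievable iff $\varphi$ is unknowable.
   Context: Formulas (single agent) are built from a nonempty set $\mathbf{Prop}$ of proposition letters by $\varphi:=p\mid\lnot\varphi\mid\varphi\land\psi\mid\Box\varphi$; other connectives and $\Diamond=\lnot\Box\lnot$ are abbreviations. Kripke models $M=(W,R,V)$ and truth are standard. K is the class of all frames; KD: $R$ serial; KD45: $R$ serial, transitive, Euclidean; S5: $R$ an equivalence relation. A formula is satisfiable in a class $\mathcal{K}$ if it is true at some state of some model based on a frame in $\mathcal{K}$, and valid in $\mathcal{K}$ if true at all states of all such models. $\varphi$ is believable in $\mathcal{K}$ iff $\Box\varphi$ is satisfiable in $\mathcal{K}$, and knowable in $\mathcal{K}$ iff $\varphi\land\Box\varphi$ is satisfiable in $\mathcal{K}$. Unbelievable means not believable; unknowable means not knowable. -}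

module Defs where

open import Data.Product using (_×_; Σ-syntax; ∃-syntax)
open import Level using (0ℓ)
open import Relation.Binary.Core using (Rel)
open import Relation.Binary.Definitions using (Transitive)
open import Relation.Binary.Structures using (IsEquivalence)
open import Relation.Nullary using (¬_)
open import Relation.Unary using (Pred)
open import Data.Unit using (⊤)

infix  30 ~_ □_
infixr 25 _∧_
infixr 20 _⊃_
infix  15 _≣_
infix  4 _,_⊨_

data Formula (Atom : Set) : Set where
  var : Atom → Formula Atom
  ~_  : Formula Atom → Formula Atom
  _∧_ : Formula Atom → Formula Atom → Formula Atom
  □_  : Formula Atom → Formula Atom

-- The object-language connectives → and ↔, as the usual classical
-- abbreviations in terms of negation and conjunction.
_⊃_ _≣_ : {Atom : Set} → Formula Atom → Formula Atom → Formula Atom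
φ ⊃ ψ = ~ (φ ∧ ~ ψ)
φ ≣ ψ = (φ ⊃ ψ) ∧ (ψ ⊃ φ)

record Frame : Set₁ where
  field
    World    : Set
    nonempty : World
    R        : Rel World 0ℓ

record Model (Atom : Set) : Set₁ where
  field
    frame : Frame
  open Frame frame public
  field
    V : Atom → Pred World 0ℓ

_,_⊨_ : {Atom : Set} (M : Model Atom) → Model.World M → Formula Atom → Set
M , w ⊨ var p = Model.V M p w
M , w ⊨ ~ φ   = ¬ (M , w ⊨ φ)
M , w ⊨ φ ∧ ψ = (M , w ⊨ φ) × (M , w ⊨ ψ)
M , w ⊨ □ φ   = ∀ v → Model.R M w v → M , v ⊨ φ

Serial : {W : Set} → Rel W 0ℓ → Set
Serial R = ∀ x → ∃[ y ] R x y

Euclidean : {W : Set} → Rel W 0ℓ → Set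
Euclidean R = ∀ {x y z} → R x y → R x z → R y z

FrameClass : Set₁
FrameClass = Pred Frame 0ℓ

K KD KD45 S5 : FrameClass
K    F = ⊤
KD   F = Serial (Frame.R F)
KD45 F = Serial (Frame.R F) × Transitive (Frame.R F) × Euclidean (Frame.R F)
S5   F = IsEquivalence (Frame.R F)

module _ {Atom : Set} (𝒦 : FrameClass) (φ : Formula Atom) where

  Satisfiable : Set₁
  Satisfiable = Σ[ M ∈ Model Atom ] 𝒦 (Model.frame M) × (∃[ w ] M , w ⊨ φ)

  Valid : Set₁
  Valid = (M : Model Atom) → 𝒦 (Model.frame M) → ∀ w → M , w ⊨ φ

module _ {Atom : Set} (𝒦 : FrameClass) (φ : Formula Atom) where

  Believable Knowable Unbelievable Unknowable : Set₁
  Believable   = Satisfiable 𝒦 (□ φ)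
  Knowable     = Satisfiable 𝒦 (φ ∧ □ φ)
  Unbelievable = ¬ Believable
  Unknowable   = ¬ Knowable

{-# OPTIONS --safe #-}
module Submission where

-- Everything reduces to unfolding truth at a state.  In any class, validity of
-- φ ↔ (φ ∧ ¬□φ) says exactly that no state satisfies both φ and □φ, and a state
-- that satisfies φ ∧ □φ satisfies □φ.  The Moore sentence p ∧ ¬□p is never
-- known, since knowing it yields both ¬□p and □p; yet it is believed at a state
-- of the serial two-cycle (moore-believable).  When the accessibility relation
-- is serial and transitive, believing φ at w makes φ ∧ □φ true at every
-- successor of w, so believable formulas are knowable (believable⇒knowable).
-- The arguments are all constructive, so no excluded middle is needed even
-- though truth is valued in types.

open import Defs
open import Data.Bool using (Bool; true; false; not)
open import Data.Product using (_×_; _,_; ∃-syntax; proj₁; proj₂)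
open import Data.Unit using (tt)
open import Function.Base using (_∘_)
open import Function.Bundles using (_⇔_; mk⇔)
open import Relation.Binary.Definitions using (Transitive)
open import Relation.Binary.PropositionalEquality using (_≡_; refl)
open import Relation.Binary.Structures using (IsEquivalence)
open import Relation.Nullary using (contradiction)

module _ {Atom : Set} (𝒦 : FrameClass) (φ : Formula Atom) where

  unknowable⇔valid : Unknowable 𝒦 φ ⇔ Valid 𝒦 (φ ≣ φ ∧ ~ □ φ)
  unknowable⇔valid = mk⇔
    (λ unknowable M M∈𝒦 w →
        (λ (⊨φ , ¬conj) →
          ¬conj (⊨φ , λ ⊨□φ → unknowable (M , M∈𝒦 , w , ⊨φ , ⊨□φ)))
      , (λ ((⊨φ , _) , ¬φ) → ¬φ ⊨φ))
    (λ valid (M , M∈𝒦 , w , ⊨φ , ⊨□φ) →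
      proj₁ (valid M M∈𝒦 w) (⊨φ , λ (_ , ¬□φ) → ¬□φ ⊨□φ))

  knowable⇒believable : Knowable 𝒦 φ → Believable 𝒦 φ
  knowable⇒believable (M , M∈𝒦 , w , _ , ⊨□φ) = M , M∈𝒦 , w , ⊨□φ

  unbelievable⇒unknowable : Unbelievable 𝒦 φ → Unknowable 𝒦 φ
  unbelievable⇒unknowable = _∘ knowable⇒believable

  module _ (serial×transitive : ∀ F → 𝒦 F →
              Serial (Frame.R F) × Transitive (Frame.R F)) where

    -- The state that witnesses knowability is a successor v of the state w
    -- where φ is believed: by transitivity, successors of v are successors of w.
    believable⇒knowable : Believable 𝒦 φ → Knowable 𝒦 φ
    believable⇒knowable (M , M∈𝒦 , w , ⊨□φ) =
      let serial , transitive = serial×transitive (Model.frame M) M∈𝒦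
          v , wRv             = serial w
      in M , M∈𝒦 , v , ⊨□φ v wRv , λ u vRu → ⊨□φ u (transitive wRv vRu)

    unbelievable⇔unknowable : Unbelievable 𝒦 φ ⇔ Unknowable 𝒦 φ
    unbelievable⇔unknowable = mk⇔ unbelievable⇒unknowable (_∘ believable⇒knowable)

-- The Moore sentence "p, but p is not believed".
moore : {Atom : Set} → Atom → Formula Atom
moore p = var p ∧ ~ □ var p

moore-unknowable : {Atom : Set} (𝒦 : FrameClass) (p : Atom) →
                   Unknowable 𝒦 (moore p)
moore-unknowable 𝒦 p (_ , _ , _ , (_ , ¬□p) , ⊨□moore) =
  ¬□p (λ v wRv → proj₁ (⊨□moore v wRv))

-- Two states, each seeing only the other; every atom holds at true and fails
-- at false.
two-cycle : (Atom : Set) → Model Atom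
two-cycle Atom = record
  { frame = record { World = Bool ; nonempty = false ; R = λ x y → y ≡ not x }
  ; V     = λ _ x → x ≡ true
  }

-- At false the only successor is true, where p holds, while p fails at the
-- successor false of true.
moore-believable : {Atom : Set} (𝒦 : FrameClass) (p : Atom) →
                   𝒦 (Model.frame (two-cycle Atom)) → Believable 𝒦 (moore p)
moore-believable {Atom} 𝒦 p M∈𝒦 = two-cycle Atom , M∈𝒦 , false , ⊨□moore
  where
  ⊨□moore : two-cycle Atom , false ⊨ □ moore p
  ⊨□moore .true refl = refl , λ ⊨□p → contradiction (⊨□p false refl) λ ()

KD45-serial×transitive : ∀ F → KD45 F →
                         Serial (Frame.R F) × Transitive (Frame.R F)
KD45-serial×transitive _ (serial , transitive , _) = serial , transitive

S5-serial×transitive : ∀ F → S5 F →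
                       Serial (Frame.R F) × Transitive (Frame.R F)
S5-serial×transitive _ equiv = (λ x → x , E.refl) , E.trans
  where module E = IsEquivalence equiv

lemma2 : {Atom : Set} (p₀ : Atom) →
    -- (a)
    ( ((φ : Formula Atom) → Unknowable K    φ ⇔ Valid K    (φ ≣ φ ∧ ~ □ φ))
    × ((φ : Formula Atom) → Unknowable KD   φ ⇔ Valid KD   (φ ≣ φ ∧ ~ □ φ))
    × ((φ : Formula Atom) → Unknowable KD45 φ ⇔ Valid KD45 (φ ≣ φ ∧ ~ □ φ))
    × ((φ : Formula Atom) → Unknowable S5   φ ⇔ Valid S5   (φ ≣ φ ∧ ~ □ φ)) )
    ×
    -- (b)
    ( ((φ : Formula Atom) → Unbelievable K φ → Unknowable K φ)
    × (∃[ φ ] Unknowable {Atom} K φ × Believable K φ)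
    × ((φ : Formula Atom) → Unbelievable KD φ → Unknowable KD φ)
    × (∃[ φ ] Unknowable {Atom} KD φ × Believable KD φ) )
    ×
    -- (c)
    ( ((φ : Formula Atom) → Unbelievable KD45 φ ⇔ Unknowable KD45 φ)
    × ((φ : Formula Atom) → Unbelievable S5 φ ⇔ Unknowable S5 φ) )
lemma2 p₀ =
    ( unknowable⇔valid K , unknowable⇔valid KD
    , unknowable⇔valid KD45 , unknowable⇔valid S5 )
  , ( unbelievable⇒unknowable K
    , (moore p₀ , moore-unknowable K p₀ , moore-believable K p₀ tt)
    , unbelievable⇒unknowable KD
    , ( moore p₀ , moore-unknowable KD p₀
      , moore-believable KD p₀ (λ x → not x , refl) ) )
  , ( (λ φ → unbelievable⇔unknowable KD45 φ KD45-serial×transitive)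
    , (λ φ → unbelievable⇔unknowable S5 φ S5-serial×transitive) )
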